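{- Let $\Sigma$ be a fixed finite alphabet. Then $\mathcal{P}_4(n) \in \Theta(n^{3/2})$, where $\mathcal{P}_4(n) = \max\{ |\mathrm{Pal}(T)| : T \in \mathcal{T}_4,\ |T| \le n\}$.
   Context: A tree is a finite undirected, acyclic, connected graph; here every edge is labeled by a letter of the finite alphabet $\Sigma$. For nodes $x,y$, $\pi(x,y)\in\Sigma^*$ is the word of labels read along the unique simple path from $x$ to $y$ ($\pi(x,x)$ is the empty word). The language of $T$ is $\mathcal{L}(T)=\{\pi(x,y): x,y \text{ nodes of } T\}$, and $\mathrm{Pal}(T)=\{w\in\mathcal{L}(T): w=\widetilde{w}\}$, where $\widetilde w$ is the reversal of $w$ (the empty word is a palindrome). The size $|T|$ is the number of edges. For a word $w$, $\Delta(w)$ is its run-length encoding (the sequence of lengths of maximal blocks of equal letters), so $|\Delta(w)|$ is the number of blocks of $w$. For $k\ge1$, $\mathcal{T}_k$ is the set of such labeled trees $T$ with $|\Delta(f)|\le k$ for all $f\in\mathcal{L}(T)$, and $\mathcal{P}_k(n)=\max_{T\in\mathcal{T}_k,\,|T|\le n}|\mathrm{Pal}(T)|$.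
   Formalization: The alphabet is required to have at least two letters, because over a one-letter alphabet every tree with at most n edges has at most n + 1 palindromes and the claimed growth n^{3/2} fails. -}

module Defs where

open import Data.Nat using (ℕ; zero; suc; _+_; _≤_)
open import Data.Fin using (Fin)
open import Data.Fin.Properties using (_≟_)
open import Data.List using (List; []; _∷_; _++_; reverse; length)
open import Data.List.Membership.Propositional using (_∈_)
open import Data.List.Relation.Unary.Any using (index)
open import Data.List.Relation.Unary.Unique.Propositional using (Unique)
open import Data.Product using (Σ; _×_; _,_)
open import Relation.Binary.PropositionalEquality using (_≡_; _≢_)
open import Relation.Nullary using (yes; no)
open import Function.Bundles using (_⇔_)

Word : ℕ → Set
Word k = List (Fin k)

-- Edge-labelled finite trees, presented as rooted trees (every finite tree can be
-- rooted at an arbitrary node; the language does not depend on the choice of root).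
-- A node is a list of children, each child given with the label of the edge to it.
data Tree (k : ℕ) : Set where
  node : List (Fin k × Tree k) → Tree k

mutual
  size : ∀ {k} → Tree k → ℕ
  size (node cs) = sizeL cs

  sizeL : ∀ {k} → List (Fin k × Tree k) → ℕ
  sizeL [] = 0
  sizeL ((a , s) ∷ cs) = suc (size s + sizeL cs)

data Down {k : ℕ} : Tree k → Word k → Set where
  stop : ∀ {t} → Down t []
  step : ∀ {cs a s w} → (a , s) ∈ cs → Down s w → Down (node cs) (a ∷ w)

-- Peak t w : w = π(x,y) for nodes x,y of t whose path passes through the root of t
-- (i.e. the root is the highest node on the path).
data Peak {k : ℕ} : Tree k → Word k → Set where
  up   : ∀ {t u} → Down t u → Peak t (reverse u)
  down : ∀ {t v} → Down t v → Peak t v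
  both : ∀ {cs a s b r u v} (p : (a , s) ∈ cs) (q : (b , r) ∈ cs) →
         index p ≢ index q → Down s u → Down r v →
         Peak (node cs) (reverse (a ∷ u) ++ (b ∷ v))

data _⊑_ {k : ℕ} : Tree k → Tree k → Set where
  here  : ∀ {t} → t ⊑ t
  there : ∀ {t cs a s} → (a , s) ∈ cs → t ⊑ s → t ⊑ node cs

-- w ∈ 𝓛(T): w = π(x,y) for some nodes x, y (the path's highest node is the root of some subtree).
InL : ∀ {k} → Tree k → Word k → Set
InL t w = Σ _ λ s → (s ⊑ t) × Peak s w

Palindrome : ∀ {k} → Word k → Set
Palindrome w = w ≡ reverse w

rleFrom : ∀ {k} → Fin k → ℕ → Word k → List ℕ
rleFrom a c [] = c ∷ []
rleFrom a c (b ∷ w) with a ≟ b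
... | yes _ = rleFrom a (suc c) w
... | no _  = c ∷ rleFrom b 1 w

Δ : ∀ {k} → Word k → List ℕ
Δ [] = []
Δ (a ∷ w) = rleFrom a 1 w

InTk : ∀ {k} → ℕ → Tree k → Set
InTk m t = ∀ w → InL t w → length (Δ w) ≤ m

-- xs is a duplicate-free enumeration of Pal(T); hence |Pal(T)| = length xs.
PalEnum : ∀ {k} → Tree k → List (Word k) → Set
PalEnum t xs = Unique xs × (∀ w → (w ∈ xs) ⇔ (InL t w × Palindrome w))

{-# OPTIONS --safe #-}
module Submission where

-- A palindrome with at most four runs is empty, a power a^i, or a^i b^j a^i.
--
-- Upper bound: fix a, b and m ≈ √n.  There are O(n) powers and O(m n) words a^i b^j a^i
-- with i < m.  If the highest node of the path lies on an end block a^i, the other end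
-- of the path determines the word, which leaves O(n) words.  Otherwise b^j joins two
-- maximal a-branches; two branches of lengths h₁ and h₂ determine j and contribute at
-- most min(h₁, h₂) words, which is at most h₁ h₂ / m if both lengths are ≥ m.  Branches
-- are disjoint, so the products h₁ h₂ add up to at most n², giving n² / m words.
--
-- Lower bound: a path of Θ(m²) edges b with 2m + 1 branches a^m, placed so that every
-- distance up to the length of the path occurs between two of them, has O(m²) edges
-- and contains all a^i b^j a^i with i ≤ m and j ≤ m², which makes Ω(m³) palindromes.

open import Defs
open import Data.Fin using (Fin; zero; suc)
open import Data.Fin.Properties using (_≟_)
open import Data.List using (List; []; _∷_; _++_; length; reverse; _ʳ++_; replicate; map; upTo; allFin; cartesianProductWith; concatMap)
open import Data.List.Membership.Propositional using (_∈_; lose)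
open import Data.List.Membership.Propositional.Properties
open import Data.List.Properties hiding (sum-++)
open import Data.List.Relation.Binary.Disjoint.Propositional using (Disjoint)
open import Data.List.Relation.Unary.All using (All; []; _∷_)
import Data.List.Relation.Unary.All as All
open import Data.List.Relation.Unary.All.Properties using () renaming (++⁺ to all-++⁺; replicate⁺ to all-replicate⁺)
open import Data.List.Relation.Unary.AllPairs using ([]; _∷_)
open import Data.List.Relation.Unary.Any using (Any; here; there; index)
import Data.List.Relation.Unary.Any as Any
open import Data.List.Relation.Unary.Any.Properties using (++⁺ˡ; ++⁺ʳ; cartesianProductWith⁺) renaming (map⁺ to any-map⁺)
open import Data.List.Relation.Unary.Unique.Propositional using (Unique)
import Data.List.Relation.Unary.Unique.Propositional.Properties as Unique
open import Data.Nat using (ℕ; zero; suc; _+_; _*_; _^_; _≤_; _<_; z≤n; s≤s; _≤′_; ≤′-refl; ≤′-step; _≤?_; _<?_; _/_; _%_; NonZero; >-nonZero⁻¹)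
open import Data.Nat.DivMod using (m≡m%n+[m/n]*n; m%n<n; m*n/n≡m; m/n*n≤m; /-monoˡ-≤)
open import Data.Nat.ListAction using (sum)
open import Data.Nat.ListAction.Properties using (sum-++)
open import Data.Nat.Properties hiding (_≟_)
open import Data.Nat.Tactic.RingSolver using (solve-∀)
open import Data.Product using (Σ; ∃; _×_; _,_; proj₁; proj₂)
open import Data.Sum using (_⊎_; inj₁; inj₂)
open import Function using (id; _∘_)
open import Function.Bundles using (mk⇔; Equivalence)
open import Relation.Binary.PropositionalEquality
open import Relation.Nullary using (yes; no; contradiction)

private
  variable
    A B C : Set
    k : ℕ

-- Lists, runs of a single letter and their reversals

unique-⊆⇒length≤ : {xs ys : List A} → Unique xs → (∀ {x} → x ∈ xs → x ∈ ys) →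
                   length xs ≤ length ys
unique-⊆⇒length≤ [] sub = z≤n
unique-⊆⇒length≤ {xs = x ∷ xs} (x∉xs ∷ uniq) sub with ∈-∃++ (sub (here refl))
... | as , bs , refl = begin
  suc (length xs)             ≤⟨ s≤s (unique-⊆⇒length≤ uniq sub′) ⟩
  suc (length (as ++ bs))     ≡⟨ cong suc (length-++ as) ⟩
  suc (length as + length bs) ≡⟨ +-suc _ _ ⟨
  length as + suc (length bs) ≡⟨ length-++ as ⟨
  length (as ++ x ∷ bs)       ∎
  where
  open ≤-Reasoning
  sub′ : ∀ {y} → y ∈ xs → y ∈ as ++ bs
  sub′ y∈xs with ∈-++⁻ as (sub (there y∈xs))
  ... | inj₁ p           = ∈-++⁺ˡ p
  ... | inj₂ (here refl) = contradiction refl (All.lookup x∉xs y∈xs)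
  ... | inj₂ (there p)   = ∈-++⁺ʳ as p

length-cartesianProductWith : (f : A → B → C) (xs : List A) (ys : List B) →
  length (cartesianProductWith f xs ys) ≡ length xs * length ys
length-cartesianProductWith f []       ys = refl
length-cartesianProductWith f (x ∷ xs) ys = trans (length-++ (map (f x) ys))
  (cong₂ _+_ (length-map (f x) ys) (length-cartesianProductWith f xs ys))

length-concatMap-≤ : (f : A → List B) (c : ℕ) → (∀ x → length (f x) ≤ c) →
  (xs : List A) → length (concatMap f xs) ≤ length xs * c
length-concatMap-≤ f c f≤c []       = z≤n
length-concatMap-≤ f c f≤c (x ∷ xs) = ≤-trans (≤-reflexive (length-++ (f x)))
  (+-mono-≤ (f≤c x) (length-concatMap-≤ f c f≤c xs))

++-split : (xs {ys} us {vs} : List A) → xs ++ ys ≡ us ++ vs →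
  (∃ λ zs → us ≡ xs ++ zs × ys ≡ zs ++ vs) ⊎ (∃ λ zs → xs ≡ us ++ zs × vs ≡ zs ++ ys)
++-split []       us       eq = inj₁ (us , refl , eq)
++-split (x ∷ xs) []       eq = inj₂ (x ∷ xs , refl , sym eq)
++-split (x ∷ xs) (u ∷ us) eq with ∷-injective eq
... | refl , eq′ with ++-split xs us eq′
...   | inj₁ (zs , p , q) = inj₁ (zs , cong (x ∷_) p , q)
...   | inj₂ (zs , p , q) = inj₂ (zs , cong (x ∷_) p , q)

replicate-+-++ : ∀ i j (x : A) (ys : List A) →
  replicate (i + j) x ++ ys ≡ replicate i x ++ (replicate j x ++ ys)
replicate-+-++ zero    j x ys = refl
replicate-+-++ (suc i) j x ys = cong (x ∷_) (replicate-+-++ i j x ys)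

replicate-++-split : ∀ n (x : A) (ys {zs} : List A) → replicate n x ≡ ys ++ zs →
  ∃ λ i → ∃ λ j → i + j ≡ n × ys ≡ replicate i x × zs ≡ replicate j x
replicate-++-split n       x []       eq = 0 , n , refl , refl , sym eq
replicate-++-split (suc n) x (y ∷ ys) eq with ∷-injective eq
... | refl , eq′ with replicate-++-split n x ys eq′
...   | i , j , refl , refl , refl = suc i , j , refl , refl , refl

replicate-++-∷ : ∀ n (x : A) ys → replicate n x ++ x ∷ ys ≡ x ∷ replicate n x ++ ys
replicate-++-∷ zero    x ys = refl
replicate-++-∷ (suc n) x ys = cong (x ∷_) (replicate-++-∷ n x ys)

ʳ++-replicate-++ : ∀ n (x : A) ys {zs} →
  (replicate n x ++ ys) ʳ++ zs ≡ ys ʳ++ (replicate n x ++ zs)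
ʳ++-replicate-++ zero    x ys = refl
ʳ++-replicate-++ (suc n) x ys {zs} =
  trans (ʳ++-replicate-++ n x ys) (cong (ys ʳ++_) (replicate-++-∷ n x zs))

ʳ++-replicate : ∀ n (x : A) {zs} → replicate n x ʳ++ zs ≡ replicate n x ++ zs
ʳ++-replicate n x {zs} = trans (cong (_ʳ++ zs) (sym (++-identityʳ (replicate n x)))) (ʳ++-replicate-++ n x [])

reverse-replicate-++ : ∀ n (x : A) ys → reverse (replicate n x ++ ys) ≡ ys ʳ++ replicate n x
reverse-replicate-++ n x ys =
  trans (ʳ++-replicate-++ n x ys) (cong (ys ʳ++_) (++-identityʳ (replicate n x)))

reverse-replicate : ∀ n (x : A) → reverse (replicate n x) ≡ replicate n x
reverse-replicate n x = trans (ʳ++-replicate n x) (++-identityʳ (replicate n x))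

reverse-replicate₂ : ∀ i j (x y : A) →
  reverse (replicate i x ++ replicate j y) ≡ replicate j y ++ replicate i x
reverse-replicate₂ i j x y = trans (reverse-replicate-++ i x _) (ʳ++-replicate j y)

reverse-replicate₃ : ∀ i j l (x y z : A) →
  reverse (replicate i x ++ (replicate j y ++ replicate l z)) ≡
  replicate l z ++ (replicate j y ++ replicate i x)
reverse-replicate₃ i j l x y z = trans (reverse-replicate-++ i x _)
  (trans (ʳ++-replicate-++ j y _) (ʳ++-replicate l z))

reverse-replicate₄ : ∀ i j l m (w x y z : A) →
  reverse (replicate i w ++ (replicate j x ++ (replicate l y ++ replicate m z))) ≡
  replicate m z ++ (replicate l y ++ (replicate j x ++ replicate i w))
reverse-replicate₄ i j l m w x y z = trans (reverse-replicate-++ i w _)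
  (trans (ʳ++-replicate-++ j x _) (trans (ʳ++-replicate-++ l y _) (ʳ++-replicate m z)))

-- The letter after a run differs from the letter of the run, so the word fixes the length of the
-- run. This matches the two ends of a palindrome and recovers i from a^i b^j a^i.
leading-run-unique : ∀ {x y z : A} → x ≢ y → x ≢ z → ∀ i j {us vs} →
  replicate i x ++ y ∷ us ≡ replicate j x ++ z ∷ vs → i ≡ j × y ∷ us ≡ z ∷ vs
leading-run-unique x≢y x≢z zero    zero    eq = refl , eq
leading-run-unique x≢y x≢z zero    (suc j) eq = contradiction (sym (∷-injectiveˡ eq)) x≢y
leading-run-unique x≢y x≢z (suc i) zero    eq = contradiction (∷-injectiveˡ eq) x≢z
leading-run-unique x≢y x≢z (suc i) (suc j) eq
  with leading-run-unique x≢y x≢z i j (∷-injectiveʳ eq)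
... | refl , eq′ = refl , eq′

run₃ : A → A → ℕ → ℕ → ℕ → List A
run₃ a b i j l = replicate i a ++ (replicate j b ++ replicate l a)

pal : A → A → ℕ → ℕ → List A
pal a b i j = run₃ a b i j i

reverse-run₃ : ∀ (a b : A) i j l → reverse (run₃ a b i j l) ≡ run₃ a b l j i
reverse-run₃ a b i j l = reverse-replicate₃ i j l a b a

-- Words with few runs

-- Blocks a w n: the word a ∷ w has n runs.
data Blocks {k} (a : Fin k) : Word k → ℕ → Set where
  one  : ∀ i → Blocks a (replicate i a) 1
  more : ∀ {b w n} i → a ≢ b → Blocks b w n → Blocks a (replicate i a ++ b ∷ w) (suc n)

blocks-∷ : {a : Fin k} {w : Word k} {n : ℕ} → Blocks a w n → Blocks a (a ∷ w) n
blocks-∷ (one i)      = one (suc i)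
blocks-∷ (more i p q) = more (suc i) p q

-- The counter `c` affects the first entry of the encoding but not the number of entries, so it may
-- be arbitrary.
blocks : (a : Fin k) (c : ℕ) (w : Word k) → Blocks a w (length (rleFrom a c w))
blocks a c [] = one 0
blocks a c (b ∷ w) with a ≟ b
... | yes refl = blocks-∷ (blocks a (suc c) w)
... | no a≢b   = more 0 a≢b (blocks b 1 w)

data PalShape {k} : Word k → Set where
  empty : PalShape []
  power : ∀ a i → PalShape (replicate (suc i) a)
  sides : ∀ {a b} i j → a ≢ b → PalShape (pal a b (suc i) (suc j))

-- The word is compared with its reversal. With two runs the first and last letters differ; with
-- three the outer runs agree in letter and length; with four the outer runs agree, and cancelling
-- the first of them makes the two adjacent inner runs share a letter.
blocks-palindrome : {a : Fin k} {w : Word k} {n : ℕ} → Blocks a w n → n ≤ 4 →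
                    Palindrome (a ∷ w) → PalShape (a ∷ w)
blocks-palindrome (one i) _ _ = power _ i
blocks-palindrome {a = a} (more {b} i a≢b (one j)) _ eq =
  contradiction (∷-injectiveˡ (trans eq (reverse-replicate₂ (suc i) (suc j) a b))) a≢b
blocks-palindrome {a = a} (more {b} i a≢b (more {c} j b≢c (one l))) _ eq
  with trans eq (reverse-replicate₃ (suc i) (suc j) (suc l) a b c)
... | eq′ with ∷-injectiveˡ eq′
...   | refl with leading-run-unique a≢b a≢b (suc i) (suc l) eq′
...     | refl , _ = sides i j a≢b
blocks-palindrome {a = a} (more {b} i a≢b (more {c} j b≢c (more {d} l c≢d (one m)))) _ eq
  with trans eq (reverse-replicate₄ (suc i) (suc j) (suc l) (suc m) a b c d)
... | eq′ with ∷-injectiveˡ eq′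
...   | refl with leading-run-unique a≢b (c≢d ∘ sym) (suc i) (suc m) eq′
...     | refl , eq″ = contradiction (∷-injectiveˡ eq″) b≢c
blocks-palindrome (more _ _ (more _ _ (more _ _ (more _ _ (one _))))) (s≤s (s≤s (s≤s (s≤s ())))) _
blocks-palindrome (more _ _ (more _ _ (more _ _ (more _ _ (more _ _ _))))) (s≤s (s≤s (s≤s (s≤s ())))) _

palindrome-shape : (w : Word k) → length (Δ w) ≤ 4 → Palindrome w → PalShape w
palindrome-shape []      _  _  = empty
palindrome-shape (a ∷ w) ≤4 eq = blocks-palindrome (blocks a 1 w) ≤4 eq

length-rleFrom : (a : Fin k) (c d : ℕ) (w : Word k) →
                 length (rleFrom a c w) ≡ length (rleFrom a d w)
length-rleFrom a c d []      = refl
length-rleFrom a c d (b ∷ w) with a ≟ b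
... | yes _ = length-rleFrom a (suc c) (suc d) w
... | no _  = refl

length-rleFrom-≤ : (a : Fin k) (c i : ℕ) (w : Word k) →
                   length (rleFrom a c (replicate i a ++ w)) ≤ suc (length (Δ w))
length-rleFrom-≤ a c zero []      = ≤-refl
length-rleFrom-≤ a c zero (b ∷ w) with a ≟ b
... | yes refl = ≤-trans (≤-reflexive (length-rleFrom a (suc c) 1 w)) (n≤1+n _)
... | no _     = ≤-refl
length-rleFrom-≤ a c (suc i) w with a ≟ a
... | yes _  = length-rleFrom-≤ a (suc c) i w
... | no a≢a = contradiction refl a≢a

-- Only an upper bound, since the new run may be empty or merge with the first run of `w`. It serves
-- to place the combs in T_4.
length-Δ-replicate-++ : (a : Fin k) (i : ℕ) (w : Word k) →
                        length (Δ (replicate i a ++ w)) ≤ suc (length (Δ w))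
length-Δ-replicate-++ a zero    w = n≤1+n _
length-Δ-replicate-++ a (suc i) w = length-rleFrom-≤ a 1 i w

length-Δ-replicate : (a : Fin k) (i : ℕ) → length (Δ (replicate i a)) ≤ 1
length-Δ-replicate a i =
  subst (λ w → length (Δ w) ≤ 1) (++-identityʳ (replicate i a)) (length-Δ-replicate-++ a i [])

length-Δ-run₃ : (a b : Fin k) (i j l : ℕ) → length (Δ (run₃ a b i j l)) ≤ 3
length-Δ-run₃ a b i j l = ≤-trans (length-Δ-replicate-++ a i _)
  (s≤s (≤-trans (length-Δ-replicate-++ b j _) (s≤s (length-Δ-replicate a l))))

-- The cut is the highest node of a path. `in-first` and `in-last` record only the side that still
-- contains all of b^j and the far end block; for a palindrome this side alone determines the word.
data RunSplit {A : Set} (a b : A) (i j l : ℕ) : List A → List A → Set where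
  in-first  : ∀ {xs} q → RunSplit a b i j l xs (run₃ a b (suc q) j l)
  in-middle : ∀ p q → p + q ≡ j →
              RunSplit a b i j l (replicate i a ++ replicate p b) (replicate q b ++ replicate l a)
  in-last   : ∀ {ys} q → RunSplit a b i j l (run₃ a b i j (suc q)) ys

run-split : (a b : A) (i j l : ℕ) (xs ys : List A) → xs ++ ys ≡ run₃ a b i j l →
            RunSplit a b i j l xs ys
run-split a b i j l xs ys eq with ++-split xs (replicate i a) eq
run-split a b i j l xs ys eq | inj₁ (zs , p , refl) with replicate-++-split i a xs p
... | i₁ , suc q , _    , refl , refl = in-first q
-- A cut at the border of a^i and b^j counts as a cut in the middle, with an empty left part of b^j.
... | i₁ , zero  , refl , refl , refl =
  subst (λ xs → RunSplit a b (i₁ + 0) j l xs (replicate j b ++ replicate l a))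
    (trans (++-identityʳ _) (cong (λ n → replicate n a) (+-identityʳ i₁)))
    (in-middle 0 j refl)
run-split a b i j l xs ys eq | inj₂ (zs , refl , eq′) with ++-split zs (replicate j b) (sym eq′)
run-split a b i j l xs ys eq | inj₂ (zs , refl , eq′) | inj₁ (_ , p , refl)
  with replicate-++-split j b zs p
... | q₁ , q₂ , q₁+q₂≡j , refl , refl = in-middle q₁ q₂ q₁+q₂≡j
run-split a b i j l xs ys eq | inj₂ (zs , refl , eq′) | inj₂ (zs′ , refl , p)
  with replicate-++-split l a zs′ p
... | suc q , l₂ , _    , refl , refl = in-last q
... | zero  , l₂ , refl , refl , refl =
  subst (λ zs → RunSplit a b i j l (replicate i a ++ zs) (replicate l a))
    (sym (++-identityʳ (replicate j b)))
    (in-middle j 0 (+-identityʳ j))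

-- Counting palindromes with two given letters

Group : Set
Group = ℕ × ℕ

-- Counts the exponents 1, ..., h of each group; exponent 0 would give b^j, which is listed among
-- the powers of b.
weight : List Group → ℕ
weight G = sum (map proj₂ G)

weight-++ : ∀ F G → weight (F ++ G) ≡ weight F + weight G
weight-++ F G = trans (cong sum (map-++ proj₂ F G)) (sum-++ (map proj₂ F) (map proj₂ G))

-- A group (j , h) stands for all pairs (i , j) with i ≤ h.
Covers : ℕ → ℕ → List Group → Set
Covers i j = Any (λ g → proj₁ g ≡ j × i ≤ proj₂ g)

lengthen : List Group → List Group
lengthen = map (λ g → suc (proj₁ g) , proj₂ g)

weight-lengthen : ∀ G → weight (lengthen G) ≡ weight G
weight-lengthen []      = refl
weight-lengthen (g ∷ G) = cong (proj₂ g +_) (weight-lengthen G)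

module _ (m : ℕ) .{{_ : NonZero m}} where

  -- If m ≤ i ≤ h₁ and i ≤ h₂ then i ≤ h₁ h₂ / m, so the height of the product
  -- may be used instead of h₁ ⊓ h₂ for exponents i ≥ m.
  _⊗_ : Group → Group → Group
  (j₁ , h₁) ⊗ (j₂ , h₂) = j₁ + j₂ , h₁ * h₂ / m

  -- Expanding the product of the two weights gives the sum of all h₁ h₂, and rounding down in the
  -- division by m only lowers each term.
  weight-⊗ : ∀ F G → weight (cartesianProductWith _⊗_ F G) * m ≤ weight F * weight G
  weight-⊗ []            G = z≤n
  weight-⊗ (f@(j , h) ∷ F) G = begin
    weight (map (f ⊗_) G ++ cartesianProductWith _⊗_ F G) * m
      ≡⟨ cong (_* m) (weight-++ (map (f ⊗_) G) _) ⟩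
    (weight (map (f ⊗_) G) + weight (cartesianProductWith _⊗_ F G)) * m
      ≡⟨ *-distribʳ-+ m (weight (map (f ⊗_) G)) _ ⟩
    weight (map (f ⊗_) G) * m + weight (cartesianProductWith _⊗_ F G) * m
      ≤⟨ +-mono-≤ (row G) (weight-⊗ F G) ⟩
    h * weight G + weight F * weight G
      ≡⟨ *-distribʳ-+ (weight G) h (weight F) ⟨
    (h + weight F) * weight G ∎
    where
    open ≤-Reasoning
    row : ∀ G → weight (map (f ⊗_) G) * m ≤ h * weight G
    row []            = z≤n
    row ((j′ , h′) ∷ G) = begin
      (h * h′ / m + weight (map (f ⊗_) G)) * m     ≡⟨ *-distribʳ-+ m (h * h′ / m) _ ⟩
      h * h′ / m * m + weight (map (f ⊗_) G) * m   ≤⟨ +-mono-≤ (m/n*n≤m (h * h′) m) (row G) ⟩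
      h * h′ + h * weight G                        ≡⟨ *-distribˡ-+ h h′ _ ⟨
      h * (h′ + weight G)                          ∎

  covers-⊗ : ∀ {i j₁ j₂ F G} → m ≤ i → Covers i j₁ F → Covers i j₂ G →
             Covers i (j₁ + j₂) (cartesianProductWith _⊗_ F G)
  covers-⊗ {i} m≤i p q = cartesianProductWith⁺ _⊗_
    (λ { (refl , i≤h₁) (refl , i≤h₂) → refl , ≤-trans (≤-reflexive (sym (m*n/n≡m i m)))
           (/-monoˡ-≤ m (*-mono-≤ i≤h₁ (≤-trans m≤i i≤h₂))) })
    p q

module Count {k : ℕ} (a b : Fin k) (m : ℕ) .{{_ : NonZero m}} where

  -- height and pendant record the words a^i and b^j a^i (j ≥ 1) read downwards from the
  -- root.  A pendant group below an edge a is completed: its j can grow no more.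
  -- joined records the words a^i b^j a^i whose highest node lies on b^j.
  record Profile : Set where
    field
      height    : ℕ
      pendant   : List Group
      completed : List Group
      joined    : List Group

    -- Reads a^i as b^0 a^i, so that an a-branch at the root itself can be joined like one that
    -- hangs below some edges b.
    groups : List Group
    groups = (0 , height) ∷ pendant

  open Profile

  none : Profile
  none = record { height = 0 ; pendant = [] ; completed = [] ; joined = [] }

  -- An edge a on top extends a^i and turns b^j a^i into a b^j a^i, which fixes j. An edge b raises
  -- every j and leaves no a-branch at the new root. Any other letter ends all words that could
  -- still grow.
  edge : Fin k → Profile → Profile
  edge c p with c ≟ a
  ... | yes _ = record p { height = suc (height p) ; pendant = [] ; completed = pendant p ++ completed p }
  ... | no _ with c ≟ b
  ...   | yes _ = record p { height = 0 ; pendant = lengthen (groups p) }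
  ...   | no _  = record p { height = 0 ; pendant = [] }

  -- Heights are added instead of maximised: the sum still dominates both sides and stays within the
  -- number of edges. Each group on one side meets each group on the other at the common root, which
  -- gives the new joined groups.
  merge : Profile → Profile → Profile
  merge p q = record
    { height    = height p + height q
    ; pendant   = pendant p ++ pendant q
    ; completed = completed p ++ completed q
    ; joined    = cartesianProductWith (_⊗_ m) (groups p) (groups q) ++ (joined p ++ joined q)
    }

  mutual
    profile : Tree k → Profile
    profile (node cs) = profiles cs

    profiles : List (Fin k × Tree k) → Profile
    profiles []             = none
    profiles ((c , s) ∷ cs) = merge (edge c (profile s)) (profiles cs)

  -- `linear` charges each unit of height to an edge a: such an edge adds 1, and later the unit only
  -- moves between `height`, `pendant` and `completed` or is dropped. `quadratic` carries the factor
  -- m to avoid the division in `_⊗_`.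
  record Bounded (n : ℕ) (p : Profile) : Set where
    constructor bounded
    field
      linear    : height p + (weight (pendant p) + weight (completed p)) ≤ n
      quadratic : weight (joined p) * m ≤ n * n

  open Bounded

  bounded-edge : ∀ {n} c {p} → Bounded n p → Bounded (suc n) (edge c p)
  bounded-edge {n} c {p} (bounded lin quad) with c ≟ a
  ... | yes _ = bounded
    (s≤s (≤-trans (≤-reflexive (cong (height p +_) (weight-++ (pendant p) (completed p)))) lin))
    (≤-trans quad (*-mono-≤ (n≤1+n n) (n≤1+n n)))
  ... | no _ with c ≟ b
  ...   | yes _ = bounded
    (≤-trans (≤-reflexive (trans
      (cong (λ w → height p + w + weight (completed p)) (weight-lengthen (pendant p)))
      (+-assoc (height p) _ _))) (≤-trans lin (n≤1+n n)))
    (≤-trans quad (*-mono-≤ (n≤1+n n) (n≤1+n n)))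
  ...   | no _ = bounded
    (≤-trans (m≤n+m _ (weight (pendant p))) (≤-trans (m≤n+m _ (height p)) (≤-trans lin (n≤1+n n))))
    (≤-trans quad (*-mono-≤ (n≤1+n n) (n≤1+n n)))

  -- By `weight-⊗` the new joined groups cost at most n₁ n₂, because `linear` bounds the weight of
  -- the groups on each side. This fits into (n₁ + n₂)² beside n₁² and n₂².
  bounded-merge : ∀ {n₁ n₂ p q} → Bounded n₁ p → Bounded n₂ q → Bounded (n₁ + n₂) (merge p q)
  bounded-merge {n₁} {n₂} {p} {q} (bounded lin₁ quad₁) (bounded lin₂ quad₂) = bounded
    (begin
      height p + height q + (weight (pendant p ++ pendant q) + weight (completed p ++ completed q))
        ≡⟨ cong₂ (λ x y → height p + height q + (x + y)) (weight-++ (pendant p) _) (weight-++ (completed p) _) ⟩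
      height p + height q + (weight (pendant p) + weight (pendant q) + (weight (completed p) + weight (completed q)))
        ≡⟨ interchange (height p) (height q) (weight (pendant p)) (weight (pendant q)) _ _ ⟩
      (height p + (weight (pendant p) + weight (completed p))) + (height q + (weight (pendant q) + weight (completed q)))
        ≤⟨ +-mono-≤ lin₁ lin₂ ⟩
      n₁ + n₂ ∎)
    (begin
      weight (cross ++ (joined p ++ joined q)) * m
        ≡⟨ cong (_* m) (trans (weight-++ cross _) (cong (weight cross +_) (weight-++ (joined p) _))) ⟩
      (weight cross + (weight (joined p) + weight (joined q))) * m
        ≡⟨ distrib (weight cross) (weight (joined p)) (weight (joined q)) m ⟩
      weight cross * m + (weight (joined p) * m + weight (joined q) * m)
        ≤⟨ +-mono-≤ (≤-trans (weight-⊗ m (groups p) (groups q)) (*-mono-≤ (groups≤ {p = p} lin₁) (groups≤ {p = q} lin₂)))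
             (+-mono-≤ quad₁ quad₂) ⟩
      n₁ * n₂ + (n₁ * n₁ + n₂ * n₂)
        ≤⟨ m≤m+n _ (n₁ * n₂) ⟩
      n₁ * n₂ + (n₁ * n₁ + n₂ * n₂) + n₁ * n₂
        ≡⟨ square n₁ n₂ ⟩
      (n₁ + n₂) * (n₁ + n₂) ∎)
    where
    open ≤-Reasoning
    cross = cartesianProductWith (_⊗_ m) (groups p) (groups q)
    interchange : ∀ u v w x y z → u + v + (w + x + (y + z)) ≡ (u + (w + y)) + (v + (x + z))
    interchange = solve-∀
    distrib : ∀ u v w x → (u + (v + w)) * x ≡ u * x + (v * x + w * x)
    distrib = solve-∀
    square : ∀ x y → x * y + (x * x + y * y) + x * y ≡ (x + y) * (x + y)
    square = solve-∀
    groups≤ : ∀ {n p} → height p + (weight (pendant p) + weight (completed p)) ≤ n → weight (groups p) ≤ n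
    groups≤ {p = p} lin = ≤-trans (+-monoʳ-≤ (height p) (m≤m+n _ _)) lin

  mutual
    bounded-profile : ∀ t → Bounded (size t) (profile t)
    bounded-profile (node cs) = bounded-profiles cs

    bounded-profiles : ∀ cs → Bounded (sizeL cs) (profiles cs)
    bounded-profiles []             = bounded z≤n z≤n
    bounded-profiles ((c , s) ∷ cs) =
      bounded-merge (bounded-edge c (bounded-profile s)) (bounded-profiles cs)

  -- Palindromes with long sides are recorded in the profile

  covers-mergeˡ : ∀ {i j} p q → Covers i j (groups p) → Covers i j (groups (merge p q))
  covers-mergeˡ p q (here (eq , i≤h)) = here (eq , ≤-trans i≤h (m≤m+n _ _))
  covers-mergeˡ p q (there x)         = there (++⁺ˡ x)

  covers-mergeʳ : ∀ {i j} p q → Covers i j (groups q) → Covers i j (groups (merge p q))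
  covers-mergeʳ p q (here (eq , i≤h)) = here (eq , ≤-trans i≤h (m≤n+m _ _))
  covers-mergeʳ p q (there x)         = there (++⁺ʳ (pendant p) x)

  groups-∈ : ∀ {i j c s cs} → (c , s) ∈ cs → Covers i j (groups (edge c (profile s))) →
             Covers i j (groups (profiles cs))
  groups-∈ {c = c} {s} {_ ∷ cs} (here refl) x = covers-mergeˡ (edge c (profile s)) (profiles cs) x
  groups-∈ {cs = (c , s) ∷ cs}  (there p)   x = covers-mergeʳ (edge c (profile s)) (profiles cs) (groups-∈ p x)

  completed-∈ : ∀ {i j c s cs} → (c , s) ∈ cs → Covers i j (completed (edge c (profile s))) →
                Covers i j (completed (profiles cs))
  completed-∈                       (here refl) x = ++⁺ˡ x
  completed-∈ {cs = (c , s) ∷ _}    (there p)   x = ++⁺ʳ (completed (edge c (profile s))) (completed-∈ p x)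

  completed-edge : ∀ {i j} c p → Covers i j (completed p) → Covers i j (completed (edge c p))
  completed-edge c p x with c ≟ a
  ... | yes _ = ++⁺ʳ (pendant p) x
  ... | no _ with c ≟ b
  ...   | yes _ = x
  ...   | no _  = x

  -- Neither `edge` nor `merge` ever drops a completed group, so what is found in a subtree is still
  -- present at the root of the whole tree.
  completed-⊑ : ∀ {i j s t} → s ⊑ t → Covers i j (completed (profile s)) → Covers i j (completed (profile t))
  completed-⊑ here                       x = x
  completed-⊑ (there {t} {cs} {c} {s} p s⊑t) x =
    completed-∈ p (completed-edge c (profile s) (completed-⊑ s⊑t x))

  joined-edge : ∀ c p → joined (edge c p) ≡ joined p
  joined-edge c p with c ≟ a
  ... | yes _ = refl
  ... | no _ with c ≟ b
  ...   | yes _ = refl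
  ...   | no _  = refl

  joined-∈ : ∀ {i j c s cs} → (c , s) ∈ cs → Covers i j (joined (profile s)) → Covers i j (joined (profiles cs))
  joined-∈ {i} {j} {c} {s} {_ ∷ cs} (here refl) x =
    ++⁺ʳ (cartesianProductWith (_⊗_ m) (groups (edge c (profile s))) (groups (profiles cs)))
      (++⁺ˡ (subst (Covers i j) (sym (joined-edge c (profile s))) x))
  joined-∈ {cs = (c , s) ∷ cs} (there p) x =
    ++⁺ʳ (cartesianProductWith (_⊗_ m) (groups (edge c (profile s))) (groups (profiles cs)))
      (++⁺ʳ (joined (edge c (profile s))) (joined-∈ p x))

  joined-⊑ : ∀ {i j s t} → s ⊑ t → Covers i j (joined (profile s)) → Covers i j (joined (profile t))
  joined-⊑ here          x = x
  joined-⊑ (there p s⊑t) x = joined-∈ p (joined-⊑ s⊑t x)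

  -- The children are merged one at a time. When the earlier of the two chosen children is merged
  -- with the rest, the other one lies in that rest, and the product of groups is formed. If the
  -- second leg uses the earlier child, the sum of exponents has to be commuted.
  joined-both : ∀ {i j₁ j₂ c s d r cs} (p : (c , s) ∈ cs) (q : (d , r) ∈ cs) → index p ≢ index q → m ≤ i →
    Covers i j₁ (groups (edge c (profile s))) → Covers i j₂ (groups (edge d (profile r))) →
    Covers i (j₁ + j₂) (joined (profiles cs))
  joined-both (here refl) (here refl) p≢q m≤i x y = contradiction refl p≢q
  joined-both (here refl) (there q)   p≢q m≤i x y = ++⁺ˡ (covers-⊗ m m≤i x (groups-∈ q y))
  joined-both {i} {j₁} {j₂} {cs = c ∷ cs} (there p) (here refl) p≢q m≤i x y =
    subst (λ j → Covers i j (joined (profiles (c ∷ cs)))) (+-comm j₂ j₁)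
      (++⁺ˡ (covers-⊗ m m≤i y (groups-∈ p x)))
  joined-both {cs = (c , s) ∷ cs} (there p) (there q) p≢q m≤i x y =
    ++⁺ʳ (cartesianProductWith (_⊗_ m) (groups (edge c (profile s))) (groups (profiles cs)))
      (++⁺ʳ (joined (edge c (profile s))) (joined-both p q (p≢q ∘ cong suc) m≤i x y))

  height-∈ : ∀ {c s cs} → (c , s) ∈ cs → height (edge c (profile s)) ≤ height (profiles cs)
  height-∈ (here refl) = m≤m+n _ _
  height-∈ (there p)   = ≤-trans (height-∈ p) (m≤n+m _ _)

  mutual
    -- The word is given by an equation, so that `Down` can be matched freely while the recursion
    -- follows the exponent.
    height-edge : ∀ i {c s u} → Down s u → c ∷ u ≡ replicate i a → i ≤ height (edge c (profile s))
    height-edge (suc i) {c} d refl with c ≟ a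
    ... | no a≢a = contradiction refl a≢a
    ... | yes _  = s≤s (height-down i d refl)

    height-down : ∀ i {t w} → Down t w → w ≡ replicate i a → i ≤ height (profile t)
    height-down zero    _          _  = z≤n
    height-down (suc i) (step p d) eq = ≤-trans (height-edge (suc i) d eq) (height-∈ p)

  module _ (a≢b : a ≢ b) where

    mutual
      -- Each leading b is an edge that lengthens the groups below it; once the b's are exhausted,
      -- the remaining a^i is found in `height`.
      groups-edge : ∀ {i} j {c s u} → Down s u → c ∷ u ≡ replicate j b ++ replicate i a →
                    Covers i j (groups (edge c (profile s)))
      groups-edge {i} zero d eq = here (refl , height-edge i d eq)
      groups-edge (suc j) {c} d refl with c ≟ a
      ... | yes b≡a = contradiction (sym b≡a) a≢b
      ... | no _ with c ≟ b
      ...   | no b≢b = contradiction refl b≢b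
      ...   | yes _  = there (any-map⁺ (Any.map (λ { (refl , i≤h) → refl , i≤h }) (groups-down j d refl)))

      groups-down : ∀ {i} j {t w} → Down t w → w ≡ replicate j b ++ replicate i a →
                    Covers i j (groups (profile t))
      groups-down {zero}  zero    stop refl = here (refl , z≤n)
      groups-down {suc i} zero    stop ()
      groups-down         (suc j) stop ()
      groups-down j (step p d) eq = groups-∈ p (groups-edge j d eq)

    mutual
      -- The lowest edge of the leading a-block is the one that moves the group of b^j a^i from
      -- `pendant` to `completed`; the edges a above it keep it there. Hence the length of this
      -- block is irrelevant to the group found.
      completed-edge-down : ∀ {i j} q {c s u} → Down s u → c ∷ u ≡ run₃ a b (suc q) (suc j) i →
                            Covers i (suc j) (completed (edge c (profile s)))
      completed-edge-down {i} {j} q {s = s} d refl with a ≟ a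
      ... | no a≢a = contradiction refl a≢a
      completed-edge-down zero {s = s} d refl | yes _ with groups-down (suc _) d refl
      -- The head of `groups` has exponent 0 and cannot match a positive power of b, so the group is
      -- pendant.
      ... | there x = ++⁺ˡ x
      completed-edge-down (suc q) {s = s} d refl | yes _ =
        ++⁺ʳ (pendant (profile s)) (completed-down q d refl)

      completed-down : ∀ {i j} q {t w} → Down t w → w ≡ run₃ a b (suc q) (suc j) i →
                       Covers i (suc j) (completed (profile t))
      completed-down q (step p d) eq = completed-∈ p (completed-edge-down q d eq)

    -- If the highest node is an end of the path or lies inside an end block, one descent contains
    -- b^j and a whole end block, and a completed group covers it. Otherwise the node cuts b^j in
    -- two, and the two descents meet in a joined group. The left leg is read upwards and must be
    -- reversed first.
    pal-peak : ∀ {i j t w} → Peak t w → w ≡ pal a b (suc i) (suc j) → m ≤ suc i →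
               Covers (suc i) (suc j) (completed (profile t)) ⊎ Covers (suc i) (suc j) (joined (profile t))
    pal-peak {i} {j} (up {u = u} d) eq _ = inj₁ (completed-down i d
      (trans (sym (reverse-involutive u)) (trans (cong reverse eq) (reverse-run₃ a b (suc i) (suc j) (suc i)))))
    pal-peak {i} (down d) eq _ = inj₁ (completed-down i d eq)
    pal-peak {i} {j} (both {cs = cs} {a = c} {b = d} {u = u} {v = v} p q p≢q du dv) eq m≤i
      = go (run-split a b (suc i) (suc j) (suc i) (reverse (c ∷ u)) (d ∷ v) eq) refl refl
      where
      go : ∀ {xs ys} → RunSplit a b (suc i) (suc j) (suc i) xs ys → reverse (c ∷ u) ≡ xs → d ∷ v ≡ ys →
           Covers (suc i) (suc j) (completed (profiles cs)) ⊎ Covers (suc i) (suc j) (joined (profiles cs))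
      go (in-first q₁) _ eq₂ = inj₁ (completed-∈ q (completed-edge-down q₁ dv eq₂))
      go (in-last q₁) eq₁ _ = inj₁ (completed-∈ p (completed-edge-down q₁ du
        (trans (sym (reverse-involutive (c ∷ u)))
          (trans (cong reverse eq₁) (reverse-run₃ a b (suc i) (suc j) (suc q₁))))))
      go (in-middle j₁ j₂ j₁+j₂≡j) eq₁ eq₂ = inj₂ (subst (λ j → Covers (suc i) j (joined (profiles cs))) j₁+j₂≡j
        (joined-both p q p≢q m≤i
          (groups-edge j₁ du (trans (sym (reverse-involutive (c ∷ u)))
            (trans (cong reverse eq₁) (reverse-replicate₂ (suc i) j₁ a b))))
          (groups-edge j₂ dv eq₂)))

    pal-covered : ∀ {i j t} → InL t (pal a b (suc i) (suc j)) → m ≤ suc i →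
                  Covers (suc i) (suc j) (completed (profile t)) ⊎ Covers (suc i) (suc j) (joined (profile t))
    pal-covered (s , s⊑t , pk) m≤i with pal-peak pk refl m≤i
    ... | inj₁ x = inj₁ (completed-⊑ s⊑t x)
    ... | inj₂ x = inj₂ (joined-⊑ s⊑t x)

  -- The list of candidate words and its length

  pals : List Group → List (Word k)
  pals = concatMap (λ g → map (λ i → pal a b (suc i) (proj₁ g)) (upTo (proj₂ g)))

  length-pals : ∀ G → length (pals G) ≡ weight G
  length-pals []            = refl
  length-pals ((j , h) ∷ G) = trans (length-++ (map (λ i → pal a b (suc i) j) (upTo h)))
    (cong₂ _+_ (trans (length-map _ (upTo h)) (length-upTo h)) (length-pals G))

  ∈-pals : ∀ {i j} G → Covers (suc i) j G → pal a b (suc i) j ∈ pals G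
  ∈-pals (g ∷ G) (here (refl , i<h)) = ∈-++⁺ˡ (∈-map⁺ (λ i → pal a b (suc i) (proj₁ g)) (∈-upTo⁺ i<h))
  ∈-pals (g ∷ G) (there x)           = ∈-++⁺ʳ (map _ (upTo (proj₂ g))) (∈-pals G x)

  -- May contain repetitions and words outside the language of `t`; only its length matters. The
  -- cutoff 2 |t| is the bound of `length-InL` on all words of `t`.
  candidates : Tree k → List (Word k)
  candidates t =
    map (λ i → replicate i a) (upTo (suc (2 * size t))) ++
    (cartesianProductWith (pal a b) (upTo m) (upTo (suc (2 * size t))) ++
    (pals (completed (profile t)) ++ pals (joined (profile t))))

  power-∈-candidates : ∀ {i} t → i ≤ 2 * size t → replicate i a ∈ candidates t
  power-∈-candidates t i≤ = ∈-++⁺ˡ (∈-map⁺ (λ i → replicate i a) (∈-upTo⁺ (s≤s i≤)))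

  pal-∈-candidates : ∀ {i j} t → a ≢ b → InL t (pal a b (suc i) (suc j)) → suc j ≤ 2 * size t →
                     pal a b (suc i) (suc j) ∈ candidates t
  pal-∈-candidates {i} {j} t a≢b inL j≤ =
    ∈-++⁺ʳ (map (λ i → replicate i a) (upTo (suc (2 * size t)))) rest
    where
    small = cartesianProductWith (pal a b) (upTo m) (upTo (suc (2 * size t)))
    rest : pal a b (suc i) (suc j) ∈ small ++ (pals (completed (profile t)) ++ pals (joined (profile t)))
    rest with m ≤? suc i
    ... | no m≰i = ∈-++⁺ˡ (∈-cartesianProductWith⁺ (pal a b) (∈-upTo⁺ (≰⇒> m≰i)) (∈-upTo⁺ (s≤s j≤)))
    ... | yes m≤i with pal-covered a≢b inL m≤i
    ...   | inj₁ x = ∈-++⁺ʳ small (∈-++⁺ˡ (∈-pals (completed (profile t)) x))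
    ...   | inj₂ x = ∈-++⁺ʳ small (∈-++⁺ʳ (pals (completed (profile t))) (∈-pals (joined (profile t)) x))

  -- Powers cost 3n, words with i < m cost 3mn, completed groups n. Joined groups cost n² / m, which
  -- n ≤ 20 m² turns into 20mn. The linear terms, 4n in total, are at most 4mn.
  length-candidates : ∀ {n} t → size t ≤ n → m * m ≤ n → n ≤ 20 * (m * m) →
                      length (candidates t) ≤ 27 * (m * n)
  length-candidates {n} t size≤n m²≤n n≤20m² = begin
    length (candidates t)
      ≡⟨ length-++ (map (λ i → replicate i a) (upTo (suc (2 * size t)))) ⟩
    length (map (λ i → replicate i a) (upTo (suc (2 * size t)))) + length (small ++ (pals comps ++ pals joins))
      ≡⟨ cong₂ _+_ (trans (length-map (λ i → replicate i a) (upTo (suc (2 * size t)))) (length-upTo (suc (2 * size t))))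
           (trans (length-++ small) (cong₂ _+_
              (trans (length-cartesianProductWith (pal a b) (upTo m) _) (cong₂ _*_ (length-upTo m) (length-upTo (suc (2 * size t)))))
              (trans (length-++ (pals comps)) (cong₂ _+_ (length-pals comps) (length-pals joins))))) ⟩
    suc (2 * size t) + (m * suc (2 * size t) + (weight comps + weight joins))
      ≤⟨ +-mono-≤ short (+-mono-≤ (*-monoʳ-≤ m short) (+-mono-≤ comps≤ joins≤)) ⟩
    3 * n + (m * (3 * n) + (n + 20 * (m * n)))
      ≡⟨ collect m n ⟩
    4 * n + 23 * (m * n)
      ≤⟨ +-monoˡ-≤ (23 * (m * n)) (*-monoʳ-≤ 4 (m≤n*m n m)) ⟩
    4 * (m * n) + 23 * (m * n)
      ≡⟨ *-distribʳ-+ (m * n) 4 23 ⟨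
    27 * (m * n) ∎
    where
    open ≤-Reasoning
    comps = completed (profile t)
    joins = joined (profile t)
    small = cartesianProductWith (pal a b) (upTo m) (upTo (suc (2 * size t)))
    bd = bounded-profile t
    collect : ∀ m n → 3 * n + (m * (3 * n) + (n + 20 * (m * n))) ≡ 4 * n + 23 * (m * n)
    collect = solve-∀
    1≤n : 1 ≤ n
    1≤n = ≤-trans (*-mono-≤ (>-nonZero⁻¹ m) (>-nonZero⁻¹ m)) m²≤n
    short : suc (2 * size t) ≤ 3 * n
    short = +-mono-≤ 1≤n (*-monoʳ-≤ 2 size≤n)
    comps≤ : weight comps ≤ n
    comps≤ = ≤-trans (≤-trans (m≤n+m _ (weight (pendant (profile t)))) (m≤n+m _ (height (profile t))))
           (≤-trans (linear bd) size≤n)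
    joins≤ : weight joins ≤ 20 * (m * n)
    joins≤ = *-cancelʳ-≤ _ _ m (begin
      weight joins * m         ≤⟨ quadratic bd ⟩
      size t * size t      ≤⟨ *-mono-≤ size≤n size≤n ⟩
      n * n                ≤⟨ *-monoˡ-≤ n n≤20m² ⟩
      20 * (m * m) * n     ≡⟨ rearrange m n ⟩
      20 * (m * n) * m     ∎)
      where
      rearrange : ∀ m n → 20 * (m * m) * n ≡ 20 * (m * n) * m
      rearrange = solve-∀

-- Word lengths and the upper bound

size-∈ : ∀ {c : Fin k} {s cs} → (c , s) ∈ cs → suc (size s) ≤ sizeL cs
size-∈ {cs = (c , s) ∷ cs} (here refl) = s≤s (m≤m+n _ _)
size-∈ {cs = (c , s) ∷ cs} (there p)   = ≤-trans (size-∈ p) (≤-trans (m≤n+m _ (size s)) (n≤1+n _))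

size-⊑ : {s t : Tree k} → s ⊑ t → size s ≤ size t
size-⊑ here          = ≤-refl
size-⊑ (there p s⊑t) = ≤-trans (size-⊑ s⊑t) (≤-trans (n≤1+n _) (size-∈ p))

length-down : {t : Tree k} {w : Word k} → Down t w → length w ≤ size t
length-down stop       = z≤n
length-down (step p d) = ≤-trans (s≤s (length-down d)) (size-∈ p)

-- The two descents are bounded separately by the size, whence the crude factor 2.
length-peak : {t : Tree k} {w : Word k} → Peak t w → length w ≤ 2 * size t
length-peak {t = t} (up {u = u} d) =
  ≤-trans (≤-reflexive (length-reverse u)) (≤-trans (length-down d) (m≤m+n _ _))
length-peak (down d) = ≤-trans (length-down d) (m≤m+n _ _)
length-peak (both {cs} {a} {u = u} p q _ d e) = ≤-trans
  (≤-reflexive (trans (length-++ (reverse (a ∷ u))) (cong (_+ _) (length-reverse (a ∷ u)))))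
  (+-mono-≤ (≤-trans (s≤s (length-down d)) (size-∈ p))
    (≤-trans (≤-trans (s≤s (length-down e)) (size-∈ q)) (m≤m+n _ 0)))

length-InL : {t : Tree k} {w : Word k} → InL t w → length w ≤ 2 * size t
length-InL (s , s⊑t , pk) = ≤-trans (length-peak pk) (*-monoʳ-≤ 2 (size-⊑ s⊑t))

-- Each of the k² ordered pairs of letters has its own candidate list; powers of a are sought under
-- the pair (a , a).
palindromes-bound : (m n : ℕ) .{{_ : NonZero m}} → m * m ≤ n → n ≤ 20 * (m * m) → Fin k →
  (T : Tree k) (xs : List (Word k)) → InTk 4 T → size T ≤ n → PalEnum T xs →
  length xs ≤ k * (k * (27 * (m * n)))
palindromes-bound {k} m n m²≤n n≤20m² a₀ T xs T∈T₄ size≤n (uniq , enum) = begin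
  length xs                                 ≤⟨ unique-⊆⇒length≤ uniq xs⊆ ⟩
  length (concatMap row (allFin k))         ≤⟨ length-concatMap-≤ row _ row≤ (allFin k) ⟩
  length (allFin k) * (k * (27 * (m * n)))  ≡⟨ cong (_* (k * (27 * (m * n)))) (length-tabulate {n = k} id) ⟩
  k * (k * (27 * (m * n)))                  ∎
  where
  open ≤-Reasoning
  open Count using (candidates; length-candidates; power-∈-candidates; pal-∈-candidates)
  row : Fin k → List (Word k)
  row a = concatMap (λ b → candidates a b m T) (allFin k)
  row≤ : ∀ a → length (row a) ≤ k * (27 * (m * n))
  row≤ a = ≤-trans
    (length-concatMap-≤ (λ b → candidates a b m T) _
      (λ b → length-candidates a b m T size≤n m²≤n n≤20m²) (allFin k))
    (≤-reflexive (cong (_* (27 * (m * n))) (length-tabulate {n = k} id)))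
  pick : ∀ a b {w} → w ∈ candidates a b m T → w ∈ concatMap row (allFin k)
  pick a b p = ∈-concatMap⁺ row {xs = allFin k} (lose (∈-allFin a)
    (∈-concatMap⁺ (λ b → candidates a b m T) {xs = allFin k} (lose (∈-allFin b) p)))
  place : ∀ {w} → PalShape w → InL T w → w ∈ concatMap row (allFin k)
  -- The empty word is the power of exponent 0 of any letter, here of `a₀`.
  place empty inL = pick a₀ a₀ (power-∈-candidates a₀ a₀ m {0} T z≤n)
  place (power a i) inL = pick a a (power-∈-candidates a a m T
    (≤-trans (≤-reflexive (sym (length-replicate (suc i)))) (length-InL inL)))
  place (sides {a} {b} i j a≢b) inL = pick a b (pal-∈-candidates a b m T a≢b inL (begin
    suc j                                               ≡⟨ length-replicate (suc j) ⟨
    length (replicate (suc j) b)                        ≤⟨ m≤m+n _ _ ⟩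
    length (replicate (suc j) b) + length (replicate (suc i) a) ≡⟨ length-++ (replicate (suc j) b) ⟨
    length (replicate (suc j) b ++ replicate (suc i) a) ≤⟨ m≤n+m _ (length (replicate (suc i) a)) ⟩
    length (replicate (suc i) a) + length (replicate (suc j) b ++ replicate (suc i) a)
      ≡⟨ length-++ (replicate (suc i) a) ⟨
    length (pal a b (suc i) (suc j))                    ≤⟨ length-InL inL ⟩
    2 * size T                                          ∎))
  xs⊆ : ∀ {w} → w ∈ xs → w ∈ concatMap row (allFin k)
  xs⊆ {w} w∈xs with Equivalence.to (enum w) w∈xs
  ... | inL , palin = place (palindrome-shape w (T∈T₄ w inL) palin) inL

-- A comb with many palindromes

module Comb {k : ℕ} (a b : Fin k) (a≢b : a ≢ b) where

  branch : ℕ → List (Fin k × Tree k)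
  branch zero    = []
  branch (suc h) = (a , node (branch h)) ∷ []

  -- The spine consists of edges b. The list gives the heights of the a-branches at its successive
  -- nodes, and `m` is the height of the branch at the far end.
  caterpillar : ℕ → List ℕ → Tree k
  caterpillar m []       = node (branch m)
  caterpillar m (h ∷ hs) = node ((b , caterpillar m hs) ∷ branch h)

  size-branch : ∀ h → sizeL (branch h) ≡ h
  size-branch zero    = refl
  size-branch (suc h) = cong suc (trans (+-identityʳ _) (size-branch h))

  size-caterpillar : ∀ m hs → size (caterpillar m hs) ≡ length hs + sum hs + m
  size-caterpillar m []       = size-branch m
  size-caterpillar m (h ∷ hs) = cong suc (begin
    size (caterpillar m hs) + sizeL (branch h) ≡⟨ cong₂ _+_ (size-caterpillar m hs) (size-branch h) ⟩
    length hs + sum hs + m + h                 ≡⟨ rearrange (length hs) (sum hs) m h ⟩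
    length hs + (h + sum hs) + m               ∎)
    where
    open ≡-Reasoning
    rearrange : ∀ w x y z → w + x + y + z ≡ w + (z + x) + y
    rearrange = solve-∀

  -- A superset of the language that is precise enough to bound the number of runs and to list all
  -- palindromes.
  data CaterpillarWord (m J : ℕ) : Word k → Set where
    in-branch  : ∀ {i} → i ≤ m → CaterpillarWord m J (replicate i a)
    over-spine : ∀ {i j l} → i ≤ m → j < J → l ≤ m → CaterpillarWord m J (run₃ a b i (suc j) l)

  word-mono : ∀ {m J J′ w} → J ≤ J′ → CaterpillarWord m J w → CaterpillarWord m J′ w
  word-mono J≤J′ (in-branch i≤m)            = in-branch i≤m
  word-mono J≤J′ (over-spine i≤m j<J l≤m) = over-spine i≤m (≤-trans j<J J≤J′) l≤m

  word-reverse : ∀ {m J w} → CaterpillarWord m J w → CaterpillarWord m J (reverse w)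
  word-reverse (in-branch {i} i≤m) = subst (CaterpillarWord _ _) (sym (reverse-replicate i a)) (in-branch i≤m)
  word-reverse (over-spine {i} {j} {l} i≤m j<J l≤m) =
    subst (CaterpillarWord _ _) (sym (reverse-run₃ a b i (suc j) l)) (over-spine l≤m j<J i≤m)

  down-branch : ∀ {h w} → Down (node (branch h)) w → ∃ λ i → i ≤ h × w ≡ replicate i a
  down-branch stop = 0 , z≤n , refl
  down-branch {suc h} (step (here refl) d) with down-branch d
  ... | i , i≤h , refl = suc i , s≤s i≤h , refl

  InL-branch : ∀ {h m J w} → h ≤ m → InL (node (branch h)) w → CaterpillarWord m J w
  InL-branch h≤m (_ , here , up d) with down-branch d
  ... | i , i≤h , refl = word-reverse (in-branch (≤-trans i≤h h≤m))
  InL-branch h≤m (_ , here , down d) with down-branch d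
  ... | i , i≤h , refl = in-branch (≤-trans i≤h h≤m)
  InL-branch {suc h} h≤m (_ , here , both (here refl) (here refl) p≢q _ _) = contradiction refl p≢q
  InL-branch {suc h} h≤m (s , there (here refl) s⊑ , pk) =
    InL-branch (≤-trans (n≤1+n h) h≤m) (s , s⊑ , pk)

  down-caterpillar : ∀ {m hs w} → All (_≤ m) hs → Down (caterpillar m hs) w →
    ∃ λ i → ∃ λ j → i ≤ m × j ≤ length hs × w ≡ replicate j b ++ replicate i a
  down-caterpillar [] d with down-branch d
  ... | i , i≤m , eq = i , 0 , i≤m , z≤n , eq
  down-caterpillar (_ ∷ _) stop = 0 , 0 , z≤n , z≤n , refl
  down-caterpillar (_ ∷ hs≤m) (step (here refl) d) with down-caterpillar hs≤m d
  ... | i , j , i≤m , j≤ , refl = i , suc j , i≤m , s≤s j≤ , refl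
  down-caterpillar (h≤m ∷ _) (step (there p) d) with down-branch (step p d)
  ... | i , i≤h , eq = i , 0 , ≤-trans i≤h h≤m , z≤n , eq

  down-word : ∀ {m hs w} → All (_≤ m) hs → Down (caterpillar m hs) w → CaterpillarWord m (length hs) w
  down-word hs≤m d with down-caterpillar hs≤m d
  ... | i , zero  , i≤m , j≤ , refl = in-branch i≤m
  ... | i , suc j , i≤m , j≤ , refl = over-spine z≤n j≤ i≤m

  -- The path climbs out of the side branch, reading a^i, then crosses the first spine edge and
  -- descends, reading a positive power of b and then a^l.
  across : ∀ {m h hs c s u w} → h ≤ m → All (_≤ m) hs → (c , s) ∈ branch h →
           Down s u → Down (caterpillar m hs) w →
           CaterpillarWord m (suc (length hs)) (reverse (c ∷ u) ++ b ∷ w)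
  across h≤m hs≤m p d e with down-branch (step p d) | down-caterpillar hs≤m e
  ... | i , i≤h , eq | l , j , l≤m , j≤ , refl =
    subst (λ v → CaterpillarWord _ _ (v ++ b ∷ _)) (sym (trans (cong reverse eq) (reverse-replicate i a)))
      (over-spine (≤-trans i≤h h≤m) (s≤s j≤) l≤m)

  -- A root has at most two children, one over b and one over a, and the two legs use different
  -- children. So such a path joins the spine to the side branch, and its two directions are mirror
  -- images.
  InL-caterpillar : ∀ {m hs w} → All (_≤ m) hs → InL (caterpillar m hs) w →
                    CaterpillarWord m (length hs) w
  InL-caterpillar [] inL = InL-branch ≤-refl inL
  InL-caterpillar hs≤m@(_ ∷ _) (_ , here , up d)   = word-reverse (down-word hs≤m d)
  InL-caterpillar hs≤m@(_ ∷ _) (_ , here , down d) = down-word hs≤m d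
  InL-caterpillar (_ ∷ _) (_ , here , both (here refl) (here refl) p≢q _ _) = contradiction refl p≢q
  InL-caterpillar (h≤m ∷ hs≤m) (_ , here , both (there p) (here refl) _ d e) = across h≤m hs≤m p d e
  InL-caterpillar (h≤m ∷ hs≤m) (_ , here , both {b = c} {u = u} {v = v} (here refl) (there q) _ d e) =
    subst (CaterpillarWord _ _)
      (trans (reverse-++ (reverse (c ∷ v)) (b ∷ u)) (cong (reverse (b ∷ u) ++_) (reverse-involutive (c ∷ v))))
      (word-reverse (across h≤m hs≤m q e d))
  InL-caterpillar {hs = suc h ∷ _} _ (_ , here , both (there (here refl)) (there (here refl)) p≢q _ _) =
    contradiction refl p≢q
  InL-caterpillar (_ ∷ hs≤m) (s , there (here refl) s⊑ , pk) =
    word-mono (n≤1+n _) (InL-caterpillar hs≤m (s , s⊑ , pk))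
  InL-caterpillar (h≤m ∷ _) (s , there (there p) s⊑ , pk) = InL-branch h≤m (s , there p s⊑ , pk)

  InTk-caterpillar : ∀ {m hs} → All (_≤ m) hs → InTk 4 (caterpillar m hs)
  InTk-caterpillar hs≤m w inL = ≤4 (InL-caterpillar hs≤m inL)
    where
    ≤4 : ∀ {m J w} → CaterpillarWord m J w → length (Δ w) ≤ 4
    ≤4 (in-branch {i} _)              = ≤-trans (length-Δ-replicate a i) (s≤s z≤n)
    ≤4 (over-spine {i} {j} {l} _ _ _) = ≤-trans (length-Δ-run₃ a b i (suc j) l) (n≤1+n 3)

  -- The exponent i = 0 in the second list supplies the powers of b, so only the powers of a are
  -- listed apart.
  palindromes : ℕ → ℕ → List (Word k)
  palindromes m J =
    map (λ i → replicate i a) (upTo (suc m)) ++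
    cartesianProductWith (λ i j → pal a b i (suc j)) (upTo (suc m)) (upTo J)

  replicate-injective : ∀ {i j} {c : Fin k} → replicate i c ≡ replicate j c → i ≡ j
  replicate-injective {i} {j} eq =
    trans (sym (length-replicate i)) (trans (cong length eq) (length-replicate j))

  pal-injective : ∀ {i i′ j j′} → pal a b i (suc j) ≡ pal a b i′ (suc j′) → i ≡ i′ × j ≡ j′
  pal-injective {i} {i′} {j} {j′} eq with leading-run-unique a≢b a≢b i i′ eq
  ... | refl , eq′ = refl , suc-injective (replicate-injective
    (++-cancelʳ (replicate i a) (replicate (suc j) b) (replicate (suc j′) b) eq′))

  replicate≢pal : ∀ i′ {i j} → replicate i a ≢ pal a b i′ (suc j)
  replicate≢pal zero     {zero}  ()
  replicate≢pal (suc i′) {zero}  ()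
  replicate≢pal zero     {suc i} eq = a≢b (∷-injectiveˡ eq)
  replicate≢pal (suc i′) {suc i} eq with replicate-++-split i a (replicate i′ a) (∷-injectiveʳ eq)
  ... | _ , suc _ , _ , _ , eq′ = a≢b (sym (∷-injectiveˡ eq′))

  palindromes-unique : ∀ m J → Unique (palindromes m J)
  palindromes-unique m J = Unique.++⁺
    (Unique.map⁺ replicate-injective (Unique.upTo⁺ (suc m)))
    (Unique.cartesianProductWith⁺ (λ i j → pal a b i (suc j)) pal-injective
      (Unique.upTo⁺ (suc m)) (Unique.upTo⁺ J))
    disjoint
    where
    disjoint : Disjoint (map (λ i → replicate i a) (upTo (suc m)))
                        (cartesianProductWith (λ i j → pal a b i (suc j)) (upTo (suc m)) (upTo J))
    disjoint (p , q) with ∈-map⁻ (λ i → replicate i a) p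
      | ∈-cartesianProductWith⁻ (λ i j → pal a b i (suc j)) (upTo (suc m)) (upTo J) q
    ... | i , _ , refl | i′ , j , _ , _ , eq = replicate≢pal i′ eq

  length-palindromes : ∀ m J → length (palindromes m J) ≡ suc m + suc m * J
  length-palindromes m J = trans (length-++ (map (λ i → replicate i a) (upTo (suc m)))) (cong₂ _+_
    (trans (length-map _ (upTo (suc m))) (length-upTo (suc m)))
    (trans (length-cartesianProductWith (λ i j → pal a b i (suc j)) (upTo (suc m)) (upTo J))
      (cong₂ _*_ (length-upTo (suc m)) (length-upTo J))))

  word-palindrome-∈ : ∀ {m J w} → CaterpillarWord m J w → Palindrome w → w ∈ palindromes m J
  word-palindrome-∈ (in-branch i≤m) _ = ∈-++⁺ˡ (∈-map⁺ (λ i → replicate i a) (∈-upTo⁺ (s≤s i≤m)))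
  word-palindrome-∈ {m} (over-spine {i} {j} {l} i≤m j<J l≤m) eq
    with leading-run-unique a≢b a≢b i l (trans eq (reverse-run₃ a b i (suc j) l))
  ... | refl , _ = ∈-++⁺ʳ (map (λ i → replicate i a) (upTo (suc m)))
    (∈-cartesianProductWith⁺ (λ i j → pal a b i (suc j)) (∈-upTo⁺ (s≤s i≤m)) (∈-upTo⁺ j<J))

  branch-down : ∀ {i h} → i ≤ h → Down (node (branch h)) (replicate i a)
  branch-down z≤n       = stop
  branch-down (s≤s i≤h) = step (here refl) (branch-down i≤h)

  down-∷ : ∀ {x cs w} → Down (node {k} cs) w → Down (node (x ∷ cs)) w
  down-∷ stop       = stop
  down-∷ (step p d) = step (there p) d

  spine-down : ∀ r {m h hs w} → Down (caterpillar m hs) w →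
               Down (caterpillar m (replicate r h ++ hs)) (replicate r b ++ w)
  spine-down zero    d = d
  spine-down (suc r) d = step (here refl) (spine-down r d)

  ⊑-caterpillar : ∀ {r s} → r ≤ s → ∀ {m h} hs →
    caterpillar m (replicate r h ++ hs) ⊑ caterpillar m (replicate s h ++ hs)
  ⊑-caterpillar {r} {s} r≤s hs = go (≤⇒≤′ r≤s)
    where
    go : ∀ {s m h} → r ≤′ s → caterpillar m (replicate r h ++ hs) ⊑ caterpillar m (replicate s h ++ hs)
    go ≤′-refl       = here
    go (≤′-step r≤s) = there (here refl) (go r≤s)

  -- A comb whose branches realise every distance

  module _ (m′ : ℕ) where

    private
      m = suc m′

    -- Each period of m spine nodes has one branch, at its first node. The branch after the last
    -- period is the one at the far end of the caterpillar.
    teeth : ℕ → List ℕ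
    teeth zero    = []
    teeth (suc q) = m ∷ (replicate m′ 0 ++ teeth q)

    -- The branches a^m sit at the positions 0, …, m - 1 and m, 2m, …, (m + 1)m of the
    -- spine; every distance from 1 to (m + 1)m is a difference q m - p of these.
    branches : List ℕ
    branches = replicate m m ++ teeth m

    comb : Tree k
    comb = caterpillar m branches

    length-teeth : ∀ q → length (teeth q) ≡ q * m
    length-teeth zero    = refl
    length-teeth (suc q) = cong suc (trans (length-++ (replicate m′ 0))
      (cong₂ _+_ (length-replicate m′) (length-teeth q)))

    length-branches : length branches ≡ m + m * m
    length-branches = trans (length-++ (replicate m m)) (cong₂ _+_ (length-replicate m) (length-teeth m))

    sum-replicate : ∀ n c → sum (replicate n c) ≡ n * c
    sum-replicate zero    c = refl
    sum-replicate (suc n) c = cong (c +_) (sum-replicate n c)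

    sum-teeth : ∀ q → sum (teeth q) ≡ q * m
    sum-teeth zero    = refl
    sum-teeth (suc q) = cong (m +_) (trans (sum-++ (replicate m′ 0) (teeth q))
      (cong₂ _+_ (trans (sum-replicate m′ 0) (*-zeroʳ m′)) (sum-teeth q)))

    size-comb : size comb ≤ 5 * (m * m)
    size-comb = begin
      size comb                             ≡⟨ size-caterpillar m branches ⟩
      length branches + sum branches + m    ≡⟨ cong₂ (λ x y → x + y + m) length-branches
                                                 (trans (sum-++ (replicate m m) (teeth m))
                                                   (cong₂ _+_ (sum-replicate m m) (sum-teeth m))) ⟩
      m + m * m + (m * m + m * m) + m       ≡⟨ collect m (m * m) ⟩
      2 * m + 3 * (m * m)                   ≤⟨ +-monoˡ-≤ (3 * (m * m)) (*-monoʳ-≤ 2 (m≤m*n m m)) ⟩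
      2 * (m * m) + 3 * (m * m)             ≡⟨ *-distribʳ-+ (m * m) 2 3 ⟨
      5 * (m * m)                           ∎
      where
      open ≤-Reasoning
      collect : ∀ x y → x + y + (y + y) + x ≡ 2 * x + 3 * y
      collect = solve-∀

    branches≤m : All (_≤ m) branches
    branches≤m = all-++⁺ (all-replicate⁺ m ≤-refl) (teeth≤m m)
      where
      teeth≤m : ∀ q → All (_≤ m) (teeth q)
      teeth≤m zero    = []
      teeth≤m (suc q) = ≤-refl ∷ all-++⁺ (all-replicate⁺ m′ z≤n) (teeth≤m q)

    -- Every q periods down there is again a branch a^m; for q = Q it is the branch at the far end.
    teeth-down : ∀ {i q Q} → i ≤ m → q ≤ Q →
                 Down (caterpillar m (teeth Q)) (replicate (q * m) b ++ replicate i a)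
    teeth-down {Q = zero}  i≤m z≤n = branch-down i≤m
    teeth-down {Q = suc Q} i≤m z≤n = down-∷ (branch-down i≤m)
    teeth-down {i} {suc q} i≤m (s≤s q≤Q) = step (here refl)
      (subst (Down _) (sym (replicate-+-++ m′ (q * m) b (replicate i a)))
        (spine-down m′ (teeth-down i≤m q≤Q)))

    power-InL : ∀ {i} → i ≤ m → InL comb (replicate i a)
    power-InL i≤m = comb , here , down (down-∷ (branch-down i≤m))

    -- Write j = r + q m with r < m. The path has its highest node r + 1 edges before the first
    -- tooth, among the dense branches, and runs q periods past that tooth, which makes j + 1 edges
    -- b.
    pal-InL : ∀ {i j} → i ≤ m → j < m + m * m → InL comb (pal a b i (suc j))
    pal-InL {i} {j} i≤m j<J = caterpillar m (replicate (suc r) m ++ teeth m) ,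
      ⊑-caterpillar (m%n<n j m) (teeth m) ,
      subst (λ v → Peak _ (replicate i a ++ b ∷ v)) spine≡ (peak i≤m)
      where
      r = j % m
      q = j / m
      j≡r+qm : j ≡ r + q * m
      j≡r+qm = m≡m%n+[m/n]*n j m
      -- From q m ≤ j < (m + 1) m.
      q≤m : q ≤ m
      q≤m = m<1+n⇒m≤n (*-cancelʳ-< m q (suc m)
        (≤-trans (s≤s (≤-trans (m≤n+m (q * m) r) (≤-reflexive (sym j≡r+qm)))) j<J))
      spine : Word k
      spine = replicate r b ++ (replicate (q * m) b ++ replicate i a)
      spine≡ : spine ≡ replicate j b ++ replicate i a
      spine≡ = trans (sym (replicate-+-++ r (q * m) b (replicate i a)))
        (cong (λ n → replicate n b ++ replicate i a) (sym j≡r+qm))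
      reach : Down (caterpillar m (replicate r m ++ teeth m)) spine
      reach = spine-down r (teeth-down i≤m q≤m)
      peak : ∀ {i′} → i′ ≤ m → Peak (caterpillar m (replicate (suc r) m ++ teeth m)) (replicate i′ a ++ b ∷ spine)
      -- Without a left block the path starts at the highest node and has a single leg.
      peak z≤n = down (step (here refl) reach)
      peak (s≤s {i″} i″≤m′) = subst
        (λ v → Peak (caterpillar m (replicate (suc r) m ++ teeth m)) (v ++ b ∷ spine))
        (reverse-replicate (suc i″) a)
        (both (there (here refl)) (here refl) (λ ()) (branch-down i″≤m′) reach)

    palEnum-comb : PalEnum comb (palindromes m (m + m * m))
    palEnum-comb = palindromes-unique m (m + m * m) , λ w → mk⇔ (to w)
      (λ { (inL , palin) → word-palindrome-∈
        (subst (λ J → CaterpillarWord m J w) length-branches (InL-caterpillar branches≤m inL)) palin })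
      where
      to : ∀ w → w ∈ palindromes m (m + m * m) → InL comb w × Palindrome w
      to w p with ∈-++⁻ (map (λ i → replicate i a) (upTo (suc m))) p
      ... | inj₁ q with ∈-map⁻ (λ i → replicate i a) q
      ...   | i , i∈ , refl = power-InL (m<1+n⇒m≤n (∈-upTo⁻ i∈)) , sym (reverse-replicate i a)
      to w p | inj₂ q
        with ∈-cartesianProductWith⁻ (λ i j → pal a b i (suc j)) (upTo (suc m)) (upTo (m + m * m)) q
      ... | i , j , i∈ , j∈ , refl =
        pal-InL (m<1+n⇒m≤n (∈-upTo⁻ i∈)) (∈-upTo⁻ j∈) , sym (reverse-run₃ a b i (suc j) i)

-- The choice of m and the final estimates

-- The factor 5 is that of `size-comb`, so the comb for m fits into n edges. Passing from n to n + 1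
-- raises m by at most one.
sqrt-scale : ∀ n → ∃ λ m → 5 * (m * m) ≤ n × n < 5 * (suc m * suc m)
sqrt-scale zero    = 0 , z≤n , s≤s z≤n
sqrt-scale (suc n) with sqrt-scale n
... | m , lo , hi with suc n <? 5 * (suc m * suc m)
...   | yes hi′ = m , ≤-trans lo (n≤1+n n) , hi′
...   | no ¬hi  = suc m , ≮⇒≥ ¬hi , ≤-trans (s≤s hi)
  (*-monoʳ-< 5 (*-mono-< (n<1+n (suc m)) (n<1+n (suc m))))

-- The comb has at least m³ palindromes, and 8000 = 20³. Squaring the count avoids the exponent 3/2.
cube-≤ : ∀ m n {l} → n ≤ 20 * (m * m) → l ≡ suc m + suc m * (m + m * m) → n ^ 3 ≤ 8000 * l ^ 2
cube-≤ m n {l} n≤ l≡ = begin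
  n ^ 3                      ≤⟨ ^-monoˡ-≤ 3 n≤ ⟩
  (20 * (m * m)) ^ 3         ≡⟨ expand m ⟩
  8000 * (m * (m * m)) ^ 2   ≤⟨ *-monoʳ-≤ 8000 (^-monoˡ-≤ 2 m³≤l) ⟩
  8000 * l ^ 2               ∎
  where
  open ≤-Reasoning
  m³≤l : m * (m * m) ≤ l
  m³≤l = ≤-trans (*-mono-≤ (n≤1+n m) (m≤n+m (m * m) m)) (≤-trans (m≤n+m _ (suc m)) (≤-reflexive (sym l≡)))
  expand : ∀ m → 20 * (m * m) * (20 * (m * m) * (20 * (m * m) * 1)) ≡
                 8000 * (m * (m * m) * (m * (m * m) * 1))
  expand = solve-∀

-- The square of 27 k² m n is 729 k⁴ m² n², and m² ≤ n replaces one factor.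
square-≤ : ∀ k m n {l} → m * m ≤ n → l ≤ k * (k * (27 * (m * n))) → l ^ 2 ≤ k ^ 4 * 729 * n ^ 3
square-≤ k m n {l} m²≤n l≤ = begin
  l ^ 2                              ≤⟨ ^-monoˡ-≤ 2 l≤ ⟩
  (k * (k * (27 * (m * n)))) ^ 2     ≡⟨ expand k m n ⟩
  k ^ 4 * 729 * (m * m * n ^ 2)      ≤⟨ *-monoʳ-≤ (k ^ 4 * 729) (*-monoˡ-≤ (n ^ 2) m²≤n) ⟩
  k ^ 4 * 729 * n ^ 3                ∎
  where
  open ≤-Reasoning
  expand : ∀ k m n → k * (k * (27 * (m * n))) * (k * (k * (27 * (m * n))) * 1) ≡
                     k * (k * (k * (k * 1))) * 729 * (m * m * (n * (n * 1)))
  expand = solve-∀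

theorem3 : (k : ℕ) → 2 ≤ k →
    Σ ℕ λ a → Σ ℕ λ b → Σ ℕ λ N → (n : ℕ) → N ≤ n →
    ((T : Tree k) (xs : List (Word k)) → InTk 4 T → size T ≤ n → PalEnum T xs →
    length xs ^ 2 ≤ b * n ^ 3)
    × (Σ (Tree k) λ T → Σ (List (Word k)) λ xs →
    InTk 4 T × size T ≤ n × PalEnum T xs × n ^ 3 ≤ a * length xs ^ 2)
-- The threshold 5 forces m ≥ 1. The two letters needed for the comb are `zero` and `suc zero`.
theorem3 k@(suc (suc _)) _ = 8000 , k ^ 4 * 729 , 5 , λ n 5≤n → bounds n 5≤n (sqrt-scale n)
  where
  open Comb {k} zero (suc zero) (λ ())
  bounds : (n : ℕ) → 5 ≤ n → (∃ λ m → 5 * (m * m) ≤ n × n < 5 * (suc m * suc m)) →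
    ((T : Tree k) (xs : List (Word k)) → InTk 4 T → size T ≤ n → PalEnum T xs →
      length xs ^ 2 ≤ k ^ 4 * 729 * n ^ 3)
    × (Σ (Tree k) λ T → Σ (List (Word k)) λ xs →
         InTk 4 T × size T ≤ n × PalEnum T xs × n ^ 3 ≤ 8000 * length xs ^ 2)
  bounds n 5≤n (zero , _ , n<5) = contradiction n<5 (≤⇒≯ 5≤n)
  bounds n 5≤n (m@(suc m′) , lo , hi) =
    (λ T xs T∈T₄ size≤n enum → square-≤ k m n m²≤n
      (palindromes-bound m n m²≤n n≤20m² zero T xs T∈T₄ size≤n enum)) ,
    comb m′ , palindromes m (m + m * m) , InTk-caterpillar (branches≤m m′) ,
    ≤-trans (size-comb m′) lo , palEnum-comb m′ ,
    cube-≤ m n n≤20m² (length-palindromes m (m + m * m))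
    where
    m²≤n : m * m ≤ n
    m²≤n = ≤-trans (m≤n*m (m * m) 5) lo
    -- For m ≥ 1 this gives n < 5 (m + 1)² ≤ 5 (2m)² = 20 m², the source of the constant 20.
    double : suc m ≤ 2 * m
    double = s≤s (≤-trans (m≤m+n m 0) (m≤n+m (m + 0) m′))
    quadruple : ∀ m → 5 * (2 * m * (2 * m)) ≡ 20 * (m * m)
    quadruple = solve-∀
    n≤20m² : n ≤ 20 * (m * m)
    n≤20m² = ≤-trans (<⇒≤ hi) (≤-trans (*-monoʳ-≤ 5 (*-mono-≤ double double)) (≤-reflexive (quadruple m)))
theorem3 (suc zero) (s≤s ())
theorem3 zero ()
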